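{- Let $d\in\mathbb N_0$, let $(P_n)_{n\ge 0}$ be the Pell sequence, and let $A_d=(a_{i,j})_{i,j=1}^{d+1}$ be the $(d+1)\times(d+1)$ matrix defined by $$a_{i,j}=\begin{cases}0 & \text{if } i>j,\\ 2 & \text{if } i=j,\\ (2^{j-i}+2)\binom{j-1}{i-1} & \text{if } i<j.\end{cases}$$ The matrix $A_d$ is invertible, with determinant $2^{d+1}\neq 0$, and therefore there exists a unique $(d+1)$-tuple $(\lambda_0(d),\lambda_1(d),\ldots,\lambda_d(d))\in\mathbb R^{d+1}$ solving the matrix equation $$A_d\,(\lambda_0(d),\lambda_1(d),\ldots,\lambda_d(d))^T = 2\left(\binom{d}{0}2^d,\binom{d}{1}2^{d-1},\ldots,\binom{d}{d}2^0\right)^T.$$ Then the polynomials $F(x),G(x),H(x)$ defined by $$F(x)=\sum_{i=0}^{d}\lambda_i(d)x^i,\qquad G(x)=-2(x+1)^d+\sum_{i=0}^{d}\lambda_i(d)(x+1)^i,\qquad H(x)=2^{d+1}-\sum_{i=0}^{d}(2^i+2)\lambda_i(d)$$ ($H$ is a constant polynomial) satisfy, for all $n\in\mathbb N$, $$2\sum_{k=1}^{n}k^dP_{k-1}=F(n)P_{n+1}+G(n)P_n+H(n).$$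
   Context: $\mathbb N$ denotes the positive integers and $\mathbb N_0=\mathbb N\cup\{0\}$. The Pell sequence $(P_n)_{n\ge0}$ is defined by $P_0=0$, $P_1=1$, $P_{k+2}=2P_{k+1}+P_k$ for all $k\ge 0$. -}

module Defs where

open import Algebra.Bundles
  using (CommutativeMonoid; CommutativeRing; CommutativeSemiring; RawRing)
open import Algebra.Structures using (IsCommutativeRing)
open import Data.Bool.Base using (if_then_else_)
open import Data.Fin.Base using (Fin; zero; suc; toℕ)
import Data.Fin.Properties as Fin
open import Data.List.Base as List using (List; []; _∷_)
open import Data.Nat.Base as ℕ using (ℕ; zero; suc; _∸_; _⊔_)
import Data.Nat.Properties as ℕ
open import Data.Nat.Combinatorics using (_C_)
open import Data.Product.Base using (∃-syntax; _×_; _,_)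
open import Data.Rational.Base as ℚ using (ℚ; 0ℚ; 1ℚ; ½; Positive)
import Data.Rational.Properties as ℚ
open import Data.Vec.Functional as Vector using (Vector)
open import Level using (0ℓ) renaming (_⊔_ to _⊔ₗ_)
open import Relation.Binary.Definitions using (tri<; tri≈; tri>)
open import Relation.Binary.PropositionalEquality
  using (_≡_; refl; sym; trans; cong; subst)
open import Relation.Nullary.Decidable using (does)

pell : ℕ → ℕ
pell 0             = 0
pell 1             = 1
pell (suc (suc k)) = 2 ℕ.* pell (suc k) ℕ.+ pell k

-- ∑₁ n f = f 1 + f 2 + ⋯ + f n
∑₁ : ℕ → (ℕ → ℕ) → ℕ
∑₁ zero    f = 0
∑₁ (suc n) f = ∑₁ n f ℕ.+ f (suc n)

------------------------------------------------------------------------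
-- Matrices and polynomials over a commutative ring

module Over {c ℓ} (R : CommutativeRing c ℓ) where

  open CommutativeRing R
    using (Carrier; _≈_; _+_; _*_; -_; _-_; 0#; 1#; commutativeSemiring)
  open import Algebra.Definitions.RawSemiring
    (CommutativeSemiring.rawSemiring commutativeSemiring)
    using (sum; _^_) renaming (_×_ to _·_)

  fromℕ : ℕ → Carrier
  fromℕ n = n · 1#

  infix 4 _≈ᵥ_ _≈ₘ_

  _≈ᵥ_ : ∀ {n} → Vector Carrier n → Vector Carrier n → Set ℓ
  u ≈ᵥ v = ∀ i → u i ≈ v i

  Matrix : ℕ → ℕ → Set c
  Matrix m n = Fin m → Fin n → Carrier

  _≈ₘ_ : ∀ {m n} → Matrix m n → Matrix m n → Set ℓ
  M ≈ₘ N = ∀ i j → M i j ≈ N i j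

  infixl 7 _*ₘ_ _*ᵥ_

  _*ₘ_ : ∀ {l m n} → Matrix l m → Matrix m n → Matrix l n
  (M *ₘ N) i k = sum (λ j → M i j * N j k)

  _*ᵥ_ : ∀ {m n} → Matrix m n → Vector Carrier n → Vector Carrier m
  (M *ᵥ v) i = sum (λ j → M i j * v j)

  identity : ∀ n → Matrix n n
  identity n i j = if does (i Fin.≟ j) then 1# else 0#

  Invertible : ∀ {n} → Matrix n n → Set (c ⊔ₗ ℓ)
  Invertible {n} M = ∃[ N ] (M *ₘ N ≈ₘ identity n × N *ₘ M ≈ₘ identity n)

  -- Laplace expansion along the first column.
  det : ∀ {n} → Matrix n n → Carrier
  det {zero}  M = 1#
  det {suc n} M = sum λ i →
    (- 1#) ^ toℕ i * (M i zero * det (λ k l → Vector.removeAt M i k (suc l)))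

  -- Univariate polynomials: coefficient lists, constant term first.
  -- Trailing zeros are allowed, so equality compares all coefficients.

  Polynomial : Set c
  Polynomial = List Carrier

  coeff : Polynomial → ℕ → Carrier
  coeff []      _       = 0#
  coeff (a ∷ p) zero    = a
  coeff (a ∷ p) (suc k) = coeff p k

  con : Carrier → Polynomial
  con a = a ∷ []

  X : Polynomial
  X = 0# ∷ 1# ∷ []

  infixl 6 _+ₚ_
  infixl 7 _*ₚ_
  infix  8 -ₚ_

  _+ₚ_ : Polynomial → Polynomial → Polynomial
  []      +ₚ q       = q
  p       +ₚ []      = p
  (a ∷ p) +ₚ (b ∷ q) = (a + b) ∷ (p +ₚ q)

  _*ₚ_ : Polynomial → Polynomial → Polynomial
  []      *ₚ q = []
  (a ∷ p) *ₚ q = List.map (a *_) q +ₚ (0# ∷ (p *ₚ q))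

  -ₚ_ : Polynomial → Polynomial
  -ₚ p = List.map (λ a → - a) p

  polynomialRawRing : RawRing c ℓ
  polynomialRawRing = record
    { Carrier = Polynomial
    ; _≈_     = λ p q → ∀ k → coeff p k ≈ coeff q k
    ; _+_     = _+ₚ_
    ; _*_     = _*ₚ_
    ; -_      = -ₚ_
    ; 0#      = []
    ; 1#      = con 1#
    }

  open import Algebra.Definitions.RawSemiring
    (RawRing.rawSemiring polynomialRawRing) public
    using () renaming (sum to sumₚ; _^_ to _^ₚ_)

  eval : Polynomial → Carrier → Carrier
  eval []      x = 0#
  eval (a ∷ p) x = a + x * eval p x

  -- Indices start at 0, so that the binomial coefficient is (j choose i)
  -- instead of (j-1 choose i-1).
  A : ∀ d → Matrix (suc d) (suc d)
  A d i j with Fin.<-cmp i j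
  ... | tri> _ _ i>j = 0#
  ... | tri≈ _ i≡j _ = fromℕ 2
  ... | tri< i<j _ _ =
    fromℕ ((2 ℕ.^ (toℕ j ∸ toℕ i) ℕ.+ 2) ℕ.* (toℕ j C toℕ i))

  rhs : ∀ d → Vector Carrier (suc d)
  rhs d i = fromℕ 2 * fromℕ ((d C toℕ i) ℕ.* 2 ℕ.^ (d ∸ toℕ i))

  IsSolution : ∀ d → Vector Carrier (suc d) → Set ℓ
  IsSolution d λs = A d *ᵥ λs ≈ᵥ rhs d

  -- F, G and H for a given tuple λs of coefficients.
  module _ (d : ℕ) (λs : Vector Carrier (suc d)) where

    F : Polynomial
    F = sumₚ (λ i → con (λs i) *ₚ X ^ₚ toℕ i)

    G : Polynomial
    G = -ₚ (con (fromℕ 2) *ₚ (X +ₚ con 1#) ^ₚ d)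
        +ₚ sumₚ (λ i → con (λs i) *ₚ (X +ₚ con 1#) ^ₚ toℕ i)

    H : Polynomial
    H = con (fromℕ (2 ℕ.^ suc d)
             - sum (λ i → fromℕ (2 ℕ.^ toℕ i ℕ.+ 2) * λs i))

------------------------------------------------------------------------
-- Identities for differences

private
  module Differences {c ℓ} (R : CommutativeRing c ℓ) where
    open CommutativeRing R
      renaming (refl to ≈-refl; sym to ≈-sym; trans to ≈-trans)
    open import Algebra.Properties.Ring ring
      using (⁻¹-anti-homo‿-; -‿+-comm; xyx⁻¹≈y; x[y-z]≈xy-xz; [y-z]x≈yx-zx)
    open import Algebra.Properties.CommutativeSemigroup
      (CommutativeMonoid.commutativeSemigroup +-commutativeMonoid)
      using (interchange)

    telescope : ∀ a b → a + (b - a) ≈ b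
    telescope a b = ≈-trans (≈-sym (+-assoc a b (- a))) (xyx⁻¹≈y a b)

    sub-+ : ∀ a b c d → (a - c) + (b - d) ≈ (a + b) - (c + d)
    sub-+ a b c d =
      ≈-trans (interchange a (- c) b (- d)) (+-congˡ (-‿+-comm c d))

    sub-neg : ∀ a b → - (a - b) ≈ (- a) - (- b)
    sub-neg a b = ≈-sym (-‿+-comm a (- b))

    sub-sym : ∀ a b → - (a - b) ≈ b - a
    sub-sym = ⁻¹-anti-homo‿-

    sub-trans : ∀ a b c → (a - b) + (b - c) ≈ a - c
    sub-trans a b c = ≈-trans (+-assoc a (- b) (b - c))
      (+-congˡ (≈-trans (≈-sym (+-assoc (- b) b (- c)))
        (≈-trans (+-congʳ (-‿inverseˡ b)) (+-identityˡ (- c)))))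

    sub-* : ∀ a b c d → a * (b - d) + d * (a - c) ≈ a * b - c * d
    sub-* a b c d = ≈-trans
      (+-cong (x[y-z]≈xy-xz a b d)
        (≈-trans (*-comm d (a - c)) ([y-z]x≈yx-zx d a c)))
      (sub-trans (a * b) (a * d) (c * d))

  open Differences ℚ.+-*-commutativeRing

------------------------------------------------------------------------
-- The real numbers: Cauchy sequences of rationals, where two sequences
-- are equal when their difference tends to zero.

IsCauchy : (ℕ → ℚ) → Set
IsCauchy x = ∀ ε → 0ℚ ℚ.< ε →
  ∃[ N ] (∀ m n → N ℕ.≤ m → N ℕ.≤ n → ℚ.∣ x m ℚ.- x n ∣ ℚ.< ε)

IsNull : (ℕ → ℚ) → Set
IsNull x = ∀ ε → 0ℚ ℚ.< ε → ∃[ N ] (∀ n → N ℕ.≤ n → ℚ.∣ x n ∣ ℚ.< ε)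

record ℝ : Set where
  constructor mkℝ
  field
    seq    : ℕ → ℚ
    cauchy : IsCauchy seq

open ℝ public

infix 4 _≈_

-- A record rather than a synonym, so that x and y can be inferred from it.
record _≈_ (x y : ℝ) : Set where
  constructor mk≈
  field
    null : IsNull (λ n → seq x n ℚ.- seq y n)

private
  -- Double sequences tending to zero; this covers both predicates above.
  Small : (ℕ → ℕ → ℚ) → Set
  Small f = ∀ ε → 0ℚ ℚ.< ε →
    ∃[ N ] (∀ m n → N ℕ.≤ m → N ℕ.≤ n → ℚ.∣ f m n ∣ ℚ.< ε)

  Bounded : (ℕ → ℕ → ℚ) → Set
  Bounded f = ∃[ B ] (Positive B ×
    ∃[ N ] (∀ m n → N ℕ.≤ m → N ℕ.≤ n → ℚ.∣ f m n ∣ ℚ.≤ B))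

  null⇒small : ∀ {x} → IsNull x → Small (λ m _ → x m)
  null⇒small h ε ε>0 with N , p ← h ε ε>0 = N , λ m _ N≤m _ → p m N≤m

  small⇒null : ∀ {x} → Small (λ m _ → x m) → IsNull x
  small⇒null h ε ε>0 with N , p ← h ε ε>0 = N , λ n N≤n → p n n N≤n N≤n

  small-resp : ∀ {f g} → (∀ m n → f m n ≡ g m n) → Small f → Small g
  small-resp f≗g h ε ε>0 with N , p ← h ε ε>0 =
    N , λ m n N≤m N≤n → subst (λ q → ℚ.∣ q ∣ ℚ.< ε) (f≗g m n) (p m n N≤m N≤n)

  small-0 : Small (λ _ _ → 0ℚ)
  small-0 ε ε>0 = 0 , λ _ _ _ _ → ε>0

  small-neg : ∀ {f} → Small f → Small (λ m n → ℚ.- f m n)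
  small-neg {f} h ε ε>0 with N , p ← h ε ε>0 =
    N , λ m n N≤m N≤n → subst (ℚ._< ε) (sym (ℚ.∣-p∣≡∣p∣ (f m n))) (p m n N≤m N≤n)

  small-+ : ∀ {f g} → Small f → Small g → Small (λ m n → f m n ℚ.+ g m n)
  small-+ {f} {g} hf hg ε ε>0
    with N , p ← hf (½ ℚ.* ε) (ℚ.*-monoʳ-<-pos ½ ε>0)
       | M , q ← hg (½ ℚ.* ε) (ℚ.*-monoʳ-<-pos ½ ε>0)
    = N ⊔ M , λ m n ≤m ≤n → ℚ.≤-<-trans (ℚ.∣p+q∣≤∣p∣+∣q∣ (f m n) (g m n))
        (subst (ℚ.∣ f m n ∣ ℚ.+ ℚ.∣ g m n ∣ ℚ.<_) halves
          (ℚ.+-mono-< (p m n (ℕ.m⊔n≤o⇒m≤o N M ≤m) (ℕ.m⊔n≤o⇒m≤o N M ≤n))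
                      (q m n (ℕ.m⊔n≤o⇒n≤o N M ≤m) (ℕ.m⊔n≤o⇒n≤o N M ≤n))))
    where
    halves : ½ ℚ.* ε ℚ.+ ½ ℚ.* ε ≡ ε
    halves = trans (sym (ℚ.*-distribʳ-+ ε ½ ½)) (ℚ.*-identityˡ ε)

  rescale : ∀ B ε → Positive B → 0ℚ ℚ.< ε → ∃[ δ ] (0ℚ ℚ.< δ × B ℚ.* δ ≡ ε)
  rescale B ε B>0 ε>0 = B⁻¹ ℚ.* ε ,
    ℚ.positive⁻¹ (B⁻¹ ℚ.* ε)
      {{ℚ.pos*pos⇒pos B⁻¹ {{ℚ.1/pos⇒pos B {{B>0}}}} ε {{ℚ.positive ε>0}}}} ,
    trans (sym (ℚ.*-assoc B B⁻¹ ε))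
      (trans (cong (ℚ._* ε) (ℚ.*-inverseʳ B {{B≢0}})) (ℚ.*-identityˡ ε))
    where
    B≢0 : ℚ.NonZero B
    B≢0 = ℚ.pos⇒nonZero B {{B>0}}

    B⁻¹ : ℚ
    B⁻¹ = (ℚ.1/ B) {{B≢0}}

  small-* : ∀ {f g} → Bounded f → Small g → Small (λ m n → f m n ℚ.* g m n)
  small-* {f} {g} (B , B>0 , N , p) hg ε ε>0
    with δ , δ>0 , B*δ≡ε ← rescale B ε B>0 ε>0
    with M , q ← hg δ δ>0
    = N ⊔ M , λ m n ≤m ≤n →
        subst (ℚ._< ε) (sym (ℚ.∣p*q∣≡∣p∣*∣q∣ (f m n) (g m n)))
          (ℚ.≤-<-trans
            (ℚ.*-monoʳ-≤-nonNeg ℚ.∣ g m n ∣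
              {{ℚ.nonNegative (ℚ.0≤∣p∣ (g m n))}}
              (p m n (ℕ.m⊔n≤o⇒m≤o N M ≤m) (ℕ.m⊔n≤o⇒m≤o N M ≤n)))
            (subst (B ℚ.* ℚ.∣ g m n ∣ ℚ.<_) B*δ≡ε
              (ℚ.*-monoʳ-<-pos B {{B>0}}
                (q m n (ℕ.m⊔n≤o⇒n≤o N M ≤m) (ℕ.m⊔n≤o⇒n≤o N M ≤n)))))

  cauchy⇒bounded : ∀ {x} → IsCauchy x → ∃[ B ] (Positive B ×
    ∃[ N ] (∀ n → N ℕ.≤ n → ℚ.∣ x n ∣ ℚ.≤ B))
  cauchy⇒bounded {x} c with N , p ← c 1ℚ (ℚ.positive⁻¹ 1ℚ) =
    ℚ.∣ x N ∣ ℚ.+ 1ℚ ,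
    ℚ.positive (ℚ.+-mono-≤-< (ℚ.0≤∣p∣ (x N)) (ℚ.positive⁻¹ 1ℚ)) ,
    N , λ n N≤n →
      subst (λ q → ℚ.∣ q ∣ ℚ.≤ ℚ.∣ x N ∣ ℚ.+ 1ℚ) (telescope (x N) (x n))
        (ℚ.≤-trans (ℚ.∣p+q∣≤∣p∣+∣q∣ (x N) (x n ℚ.- x N))
          (ℚ.+-monoʳ-≤ ℚ.∣ x N ∣ (ℚ.<⇒≤ (p n N N≤n ℕ.≤-refl))))

  boundedˡ : ∀ {x} → IsCauchy x → Bounded (λ m _ → x m)
  boundedˡ c with B , B>0 , N , p ← cauchy⇒bounded c =
    B , B>0 , N , λ m _ N≤m _ → p m N≤m

  boundedʳ : ∀ {x} → IsCauchy x → Bounded (λ _ n → x n)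
  boundedʳ c with B , B>0 , N , p ← cauchy⇒bounded c =
    B , B>0 , N , λ _ n _ N≤n → p n N≤n

fromℚ : ℚ → ℝ
fromℚ q = mkℝ (λ _ → q)
  (small-resp (λ _ _ → sym (ℚ.+-inverseʳ q)) small-0)

infixl 6 _+_
infixl 7 _*_
infix  8 -_

_+_ : ℝ → ℝ → ℝ
x + y = mkℝ (λ n → seq x n ℚ.+ seq y n)
  (small-resp (λ m n → sub-+ (seq x m) (seq y m) (seq x n) (seq y n))
    (small-+ (cauchy x) (cauchy y)))

_*_ : ℝ → ℝ → ℝ
x * y = mkℝ (λ n → seq x n ℚ.* seq y n)
  (small-resp (λ m n → sub-* (seq x m) (seq y m) (seq x n) (seq y n))
    (small-+
      (small-* {λ m _ → seq x m} {λ m n → seq y m ℚ.- seq y n}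
        (boundedˡ {seq x} (cauchy x)) (cauchy y))
      (small-* {λ _ n → seq y n} {λ m n → seq x m ℚ.- seq x n}
        (boundedʳ {seq y} (cauchy y)) (cauchy x))))

-_ : ℝ → ℝ
- x = mkℝ (λ n → ℚ.- seq x n)
  (small-resp (λ m n → sub-neg (seq x m) (seq x n)) (small-neg (cauchy x)))

0ℝ 1ℝ : ℝ
0ℝ = fromℚ 0ℚ
1ℝ = fromℚ 1ℚ

private
  pointwise : ∀ {x y} → (∀ n → seq x n ≡ seq y n) → x ≈ y
  pointwise {x} {y} x≗y = mk≈ (small⇒null (small-resp
    (λ n _ → sym (trans (cong (ℚ._- seq y n) (x≗y n)) (ℚ.+-inverseʳ (seq y n))))
    small-0))

  ≈-sym : ∀ {x y} → x ≈ y → y ≈ x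
  ≈-sym {x} {y} p = mk≈ (small⇒null (small-resp
    (λ n _ → sub-sym (seq x n) (seq y n)) (small-neg (null⇒small (_≈_.null p)))))

  ≈-trans : ∀ {x y z} → x ≈ y → y ≈ z → x ≈ z
  ≈-trans {x} {y} {z} p q = mk≈ (small⇒null (small-resp
    (λ n _ → sub-trans (seq x n) (seq y n) (seq z n))
    (small-+ (null⇒small (_≈_.null p)) (null⇒small (_≈_.null q)))))

  +-cong : ∀ {x y u v} → x ≈ y → u ≈ v → x + u ≈ y + v
  +-cong {x} {y} {u} {v} p q = mk≈ (small⇒null (small-resp
    (λ n _ → sub-+ (seq x n) (seq u n) (seq y n) (seq v n))
    (small-+ (null⇒small (_≈_.null p)) (null⇒small (_≈_.null q)))))

  *-cong : ∀ {x y u v} → x ≈ y → u ≈ v → x * u ≈ y * v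
  *-cong {x} {y} {u} {v} p q = mk≈ (small⇒null (small-resp
    (λ n _ → sub-* (seq x n) (seq u n) (seq y n) (seq v n))
    (small-+
      (small-* {λ n _ → seq x n} {λ n _ → seq u n ℚ.- seq v n}
        (boundedˡ {seq x} (cauchy x)) (null⇒small (_≈_.null q)))
      (small-* {λ n _ → seq v n} {λ n _ → seq x n ℚ.- seq y n}
        (boundedˡ {seq v} (cauchy v)) (null⇒small (_≈_.null p))))))

  -‿cong : ∀ {x y} → x ≈ y → - x ≈ - y
  -‿cong {x} {y} p = mk≈ (small⇒null (small-resp
    (λ n _ → sub-neg (seq x n) (seq y n)) (small-neg (null⇒small (_≈_.null p)))))

ℝ-isCommutativeRing : IsCommutativeRing _≈_ _+_ _*_ -_ 0ℝ 1ℝ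
ℝ-isCommutativeRing = record
  { isRing = record
    { +-isAbelianGroup = record
      { isGroup = record
        { isMonoid = record
          { isSemigroup = record
            { isMagma = record
              { isEquivalence = record
                { refl  = λ {x} → pointwise {x} {x} (λ _ → refl)
                ; sym   = λ {x y} → ≈-sym {x} {y}
                ; trans = λ {x y z} → ≈-trans {x} {y} {z}
                }
              ; ∙-cong = λ {x y u v} → +-cong {x} {y} {u} {v}
              }
            ; assoc = λ x y z → pointwise {(x + y) + z} {x + (y + z)}
                (λ n → ℚ.+-assoc (seq x n) (seq y n) (seq z n))
            }
          ; identity =
              (λ x → pointwise {0ℝ + x} {x} (λ n → ℚ.+-identityˡ (seq x n))) ,
              (λ x → pointwise {x + 0ℝ} {x} (λ n → ℚ.+-identityʳ (seq x n)))
          }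
        ; inverse =
            (λ x → pointwise { - x + x} {0ℝ} (λ n → ℚ.+-inverseˡ (seq x n))) ,
            (λ x → pointwise {x + - x} {0ℝ} (λ n → ℚ.+-inverseʳ (seq x n)))
        ; ⁻¹-cong = λ {x y} → -‿cong {x} {y}
        }
      ; comm = λ x y → pointwise {x + y} {y + x}
          (λ n → ℚ.+-comm (seq x n) (seq y n))
      }
    ; *-cong = λ {x y u v} → *-cong {x} {y} {u} {v}
    ; *-assoc = λ x y z → pointwise {(x * y) * z} {x * (y * z)}
        (λ n → ℚ.*-assoc (seq x n) (seq y n) (seq z n))
    ; *-identity =
        (λ x → pointwise {1ℝ * x} {x} (λ n → ℚ.*-identityˡ (seq x n))) ,
        (λ x → pointwise {x * 1ℝ} {x} (λ n → ℚ.*-identityʳ (seq x n)))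
    ; distrib =
        (λ x y z → pointwise {x * (y + z)} {x * y + x * z}
          (λ n → ℚ.*-distribˡ-+ (seq x n) (seq y n) (seq z n))) ,
        (λ x y z → pointwise {(y + z) * x} {y * x + z * x}
          (λ n → ℚ.*-distribʳ-+ (seq x n) (seq y n) (seq z n)))
    }
  ; *-comm = λ x y → pointwise {x * y} {y * x}
      (λ n → ℚ.*-comm (seq x n) (seq y n))
  }

ℝ-commutativeRing : CommutativeRing 0ℓ 0ℓ
ℝ-commutativeRing = record { isCommutativeRing = ℝ-isCommutativeRing }

open Over ℝ-commutativeRing public

{-# OPTIONS --safe #-}
-- Put f(x) = ∑ λᵢ xⁱ. By the binomial theorem the system A_d λ = rhs compares
-- the coefficients in
--   f(x+2) + 2 f(x+1) = f(x) + 2 (x+2)^d.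
-- Since F(x) = f(x) and G(x) = f(x+1) − 2 (x+1)^d, this equation and the Pell
-- recurrence make F(n) P_{n+1} + G(n) P_n grow by 2 (n+1)^d P_n from n to n+1;
-- its value at n = 0 is f(0), and H = −f(0) by the equation at x = 0. The matrix
-- A_d is upper triangular with diagonal entries 2.
module Submission where

open import Algebra.Bundles using (CommutativeRing)
open import Data.Fin.Base as Fin using (Fin; zero; suc; toℕ)
import Data.Fin.Properties as Fin
open import Data.List.Base as List using ([]; _∷_)
open import Data.Nat.Base as ℕ using (ℕ; zero; suc; _∸_; z≤n; s≤s)
open import Data.Nat.Combinatorics using (_C_; k>n⇒nCk≡0; nCn≡1)
import Data.Nat.Properties as ℕ
open import Data.Product using (_×_; _,_; ∃!)
open import Data.Rational.Base as ℚ using (0ℚ; 1ℚ; ½)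
import Data.Rational.Properties as ℚ
open import Data.Vec.Functional as Vector using (Vector)
open import Function.Base using (_∘_)
open import Relation.Binary.Definitions using (tri<; tri≈; tri>)
open import Relation.Binary.PropositionalEquality as ≡ using (_≡_)
open import Relation.Nullary using (¬_; yes; no; contradiction)

open import Defs using (module Over; pell; ∑₁)

module OverProperties {c ℓ} (R : CommutativeRing c ℓ) where

  open CommutativeRing R hiding (zero)
  open Over R
  open import Algebra.Properties.Ring ring
    using (-0#≈0#; -‿+-comm; -‿distribˡ-*; +-cancelʳ)
  open import Algebra.Properties.Semiring.Exp semiring using (_^_; ^-congˡ)
  open import Algebra.Properties.Semiring.Mult semiring
    using (×-assoc-*; ×-congʳ; ×-homo-+; ×1-homo-*) renaming (_×_ to _·_)
  open import Algebra.Properties.Semiring.Sum semiring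
    using (sum; sum-cong-≋; ∑-distrib-+; ∑-comm; *-distribˡ-sum; *-distribʳ-sum)
  import Algebra.Properties.CommutativeSemiring.Binomial commutativeSemiring
    as Binomial
  open import Algebra.Solver.Ring.NaturalCoefficients.Default commutativeSemiring
    using (solve; _:+_; _:*_; _:=_)
  open import Relation.Binary.Reasoning.Setoid setoid

  -- Natural numbers as ring elements, and finite sums

  fromℕ-+ : ∀ m n → fromℕ (m ℕ.+ n) ≈ fromℕ m + fromℕ n
  fromℕ-+ = ×-homo-+ 1#

  fromℕ-* : ∀ m n → fromℕ (m ℕ.* n) ≈ fromℕ m * fromℕ n
  fromℕ-* = ×1-homo-*

  fromℕ-^ : ∀ m n → fromℕ (m ℕ.^ n) ≈ fromℕ m ^ n
  fromℕ-^ m zero    = +-identityʳ 1#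
  fromℕ-^ m (suc n) = trans (fromℕ-* m (m ℕ.^ n)) (*-congˡ (fromℕ-^ m n))

  fromℕ-cong : ∀ {m n} → m ≡ n → fromℕ m ≈ fromℕ n
  fromℕ-cong = reflexive ∘ ≡.cong fromℕ

  ·-fromℕ : ∀ n x → n · x ≈ fromℕ n * x
  ·-fromℕ n x = sym (trans (×-assoc-* n 1# x) (×-congʳ n (*-identityˡ x)))

  sum-zero : ∀ {n} (f : Vector Carrier n) → (∀ i → f i ≈ 0#) → sum f ≈ 0#
  sum-zero {zero}  f f≈0 = refl
  sum-zero {suc n} f f≈0 =
    trans (+-cong (f≈0 zero) (sum-zero (f ∘ suc) (f≈0 ∘ suc))) (+-identityˡ 0#)

  -- Lets binomial expansions of different degrees run over one common index set, `Fin (suc d)`.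
  sum-truncate : ∀ {m n} → m ℕ.≤ n → (g : ℕ → Carrier) →
                 (∀ k → m ℕ.≤ k → g k ≈ 0#) →
                 sum {n} (g ∘ toℕ) ≈ sum {m} (g ∘ toℕ)
  sum-truncate {n = n} z≤n g g≈0 =
    sum-zero {n} (g ∘ toℕ) (λ i → g≈0 (toℕ i) z≤n)
  sum-truncate (s≤s m≤n) g g≈0 =
    +-congˡ (sum-truncate m≤n (g ∘ suc) (λ k m≤k → g≈0 (suc k) (s≤s m≤k)))

  -- Triangular matrices

  -- Associativity for a row, a matrix and a column, obtained by exchanging two finite sums. It
  -- gives (M N) b = M (N b) when `u` is a row of a matrix, and (r N) M = r (N M) when `v` is a
  -- column of one.
  sum-*-assoc : ∀ {m n} (u : Vector Carrier m) (M : Matrix m n)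
                (v : Vector Carrier n) →
                sum (λ j → sum (λ k → u k * M k j) * v j) ≈
                sum (λ k → u k * sum (λ j → M k j * v j))
  sum-*-assoc u M v = begin
    sum (λ j → sum (λ k → u k * M k j) * v j)
      ≈⟨ sum-cong-≋ (λ j → *-distribʳ-sum (v j) (λ k → u k * M k j)) ⟩
    sum (λ j → sum (λ k → u k * M k j * v j))
      ≈⟨ ∑-comm (λ j k → u k * M k j * v j) ⟩
    sum (λ k → sum (λ j → u k * M k j * v j))
      ≈⟨ sum-cong-≋ (λ k → sum-cong-≋ (λ j → *-assoc (u k) (M k j) (v j))) ⟩
    sum (λ k → sum (λ j → u k * (M k j * v j)))
      ≈⟨ sum-cong-≋ (λ k → *-distribˡ-sum (u k) (λ j → M k j * v j)) ⟨
    sum (λ k → u k * sum (λ j → M k j * v j)) ∎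

  identity-*ᵥ : ∀ {n} (v : Vector Carrier n) → identity n *ᵥ v ≈ᵥ v
  identity-*ᵥ v zero = trans
    (+-cong (*-identityˡ (v zero)) (sum-zero _ (λ j → zeroˡ (v (suc j)))))
    (+-identityʳ (v zero))
  -- `does (suc i Fin.≟ suc j)` reduces to `does (i Fin.≟ j)`, so the remaining sum is the same
  -- product for `v ∘ suc`.
  identity-*ᵥ v (suc i) = trans
    (+-cong (zeroˡ (v zero)) (identity-*ᵥ (v ∘ suc) i))
    (+-identityˡ (v (suc i)))

  sum-*-identity : ∀ {n} (u : Vector Carrier n) i →
                   sum (λ k → u k * identity n k i) ≈ u i
  sum-*-identity u zero = trans
    (+-cong (*-identityʳ (u zero)) (sum-zero _ (λ j → zeroʳ (u (suc j)))))
    (+-identityʳ (u zero))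
  sum-*-identity u (suc i) = trans
    (+-cong (zeroʳ (u zero)) (sum-*-identity (u ∘ suc) i))
    (+-identityˡ (u (suc i)))

  -- The right inverse property makes `N *ᵥ b` a solution; the left inverse property turns any
  -- solution `v` into N (M v) = N b.
  invertible⇒∃!-solution : ∀ {n} {M : Matrix n n} → Invertible M →
                           ∀ b → ∃! _≈ᵥ_ (λ v → M *ᵥ v ≈ᵥ b)
  invertible⇒∃!-solution {M = M} (N , MN≈I , NM≈I) b =
    N *ᵥ b ,
    (λ i → begin
      (M *ᵥ (N *ᵥ b)) i ≈⟨ sum-*-assoc (M i) N b ⟨
      ((M *ₘ N) *ᵥ b) i ≈⟨ sum-cong-≋ (λ j → *-congʳ (MN≈I i j)) ⟩
      (identity _ *ᵥ b) i ≈⟨ identity-*ᵥ b i ⟩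
      b i ∎) ,
    λ {v} Mv≈b i → begin
      (N *ᵥ b) i        ≈⟨ sum-cong-≋ (λ j → *-congˡ (Mv≈b j)) ⟨
      (N *ᵥ (M *ᵥ v)) i ≈⟨ sum-*-assoc (N i) M v ⟨
      ((N *ₘ M) *ᵥ v) i ≈⟨ sum-cong-≋ (λ j → *-congʳ (NM≈I i j)) ⟩
      (identity _ *ᵥ v) i ≈⟨ identity-*ᵥ v i ⟩
      v i ∎

  UpperTriangular : ∀ {n} → Matrix n n → Set ℓ
  UpperTriangular M = ∀ i j → j Fin.< i → M i j ≈ 0#

  minor₀ : ∀ {n} → Matrix (suc n) (suc n) → Matrix n n
  minor₀ M i j = M (suc i) (suc j)

  minor₀-upperTriangular : ∀ {n} {M : Matrix (suc n) (suc n)} →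
                           UpperTriangular M → UpperTriangular (minor₀ M)
  minor₀-upperTriangular M-upper i j j<i = M-upper (suc i) (suc j) (s≤s j<i)

  -- In the Laplace expansion along the first column only the top term survives, and its minor is
  -- again upper triangular with the same diagonal entry.
  det-upperTriangular : ∀ {n} (M : Matrix n n) a → UpperTriangular M →
                        (∀ i → M i i ≈ fromℕ a) → det M ≈ fromℕ (a ℕ.^ n)
  det-upperTriangular {zero}  M a M-upper diag = sym (+-identityʳ 1#)
  det-upperTriangular {suc n} M a M-upper diag = begin
    1# * (M zero zero * det (minor₀ M)) + sum {n} _
      ≈⟨ +-cong (*-identityˡ _) (sum-zero _ below) ⟩
    M zero zero * det (minor₀ M) + 0#
      ≈⟨ +-identityʳ _ ⟩
    M zero zero * det (minor₀ M)
      ≈⟨ *-cong (diag zero) (det-upperTriangular (minor₀ M) a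
           (minor₀-upperTriangular {M = M} M-upper) (diag ∘ suc)) ⟩
    fromℕ a * fromℕ (a ℕ.^ n)
      ≈⟨ fromℕ-* a (a ℕ.^ n) ⟨
    fromℕ (a ℕ.^ suc n) ∎
    where
    below : ∀ i → (- 1#) ^ toℕ (suc i) *
      (M (suc i) zero * det (λ k l → Vector.removeAt M (suc i) k (suc l))) ≈ 0#
    below i = trans
      (*-congˡ (trans (*-congʳ (M-upper (suc i) zero (s≤s z≤n))) (zeroˡ _)))
      (zeroʳ _)

  -- With M = [[a, r], [0, M′]] and a⁻¹, N the inverses of a and M′, the inverse
  -- of M is [[a⁻¹, −a⁻¹ r N], [0, N]].
  upperTriangular⇒invertible : ∀ {n} (M : Matrix n n) a a⁻¹ → a * a⁻¹ ≈ 1# →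
    UpperTriangular M → (∀ i → M i i ≈ a) → Invertible M
  upperTriangular⇒invertible {zero} M a a⁻¹ aa⁻¹≈1 M-upper diag =
    (λ ()) , (λ ()) , (λ ())
  upperTriangular⇒invertible {suc n} M a a⁻¹ aa⁻¹≈1 M-upper diag
    with N , MN≈I , NM≈I ← upperTriangular⇒invertible (minor₀ M) a a⁻¹ aa⁻¹≈1
           (minor₀-upperTriangular {M = M} M-upper) (diag ∘ suc)
    = M⁻¹ , right , left
    where
    r rN : Vector Carrier n
    r j  = M zero (suc j)
    rN k = sum (λ j → r j * N j k)

    M⁻¹ : Matrix (suc n) (suc n)
    M⁻¹ zero    zero    = a⁻¹
    M⁻¹ zero    (suc k) = - a⁻¹ * rN k
    M⁻¹ (suc i) zero    = 0#
    M⁻¹ (suc i) (suc k) = N i k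

    below : ∀ i → M (suc i) zero ≈ 0#
    below i = M-upper (suc i) zero (s≤s z≤n)

    a*-a⁻¹ : a * - a⁻¹ ≈ - 1#
    a*-a⁻¹ = begin
      a * - a⁻¹   ≈⟨ *-comm a (- a⁻¹) ⟩
      - a⁻¹ * a   ≈⟨ -‿distribˡ-* a⁻¹ a ⟨
      - (a⁻¹ * a) ≈⟨ -‿cong (trans (*-comm a⁻¹ a) aa⁻¹≈1) ⟩
      - 1# ∎

    right : M *ₘ M⁻¹ ≈ₘ identity (suc n)
    right zero zero = trans
      (+-cong (trans (*-congʳ (diag zero)) aa⁻¹≈1)
        (sum-zero _ (λ j → zeroʳ (r j)))) (+-identityʳ 1#)
    right zero (suc k) = begin
      M zero zero * (- a⁻¹ * rN k) + rN k
        ≈⟨ +-congʳ (trans (*-congʳ (diag zero)) (sym (*-assoc a (- a⁻¹) (rN k)))) ⟩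
      a * - a⁻¹ * rN k + rN k
        ≈⟨ +-cong (*-congʳ a*-a⁻¹) (sym (*-identityˡ (rN k))) ⟩
      - 1# * rN k + 1# * rN k   ≈⟨ distribʳ (rN k) (- 1#) 1# ⟨
      (- 1# + 1#) * rN k        ≈⟨ *-congʳ (-‿inverseˡ 1#) ⟩
      0# * rN k                 ≈⟨ zeroˡ (rN k) ⟩
      0# ∎
    right (suc i) zero = trans
      (+-cong (trans (*-congʳ (below i)) (zeroˡ a⁻¹))
        (sum-zero _ (λ j → zeroʳ (M (suc i) (suc j)))))
      (+-identityʳ 0#)
    right (suc i) (suc k) = trans
      (+-cong (trans (*-congʳ (below i)) (zeroˡ _)) (MN≈I i k))
      (+-identityˡ _)

    -- The product associates to `r` times (`N` times the minor), and `N` is a left inverse of the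
    -- minor. This makes the top right block of `M⁻¹ *ₘ M` cancel.
    rNM≈r : ∀ k → sum (λ j → rN j * M (suc j) (suc k)) ≈ r k
    rNM≈r k = begin
      sum (λ j → rN j * M (suc j) (suc k))
        ≈⟨ sum-*-assoc r N (λ j → M (suc j) (suc k)) ⟩
      sum (λ j → r j * (N *ₘ minor₀ M) j k)
        ≈⟨ sum-cong-≋ (λ j → *-congˡ (NM≈I j k)) ⟩
      sum (λ j → r j * identity n j k)
        ≈⟨ sum-*-identity r k ⟩
      r k ∎

    left : M⁻¹ *ₘ M ≈ₘ identity (suc n)
    left zero zero = trans
      (+-cong (trans (*-congˡ (diag zero)) (trans (*-comm a⁻¹ a) aa⁻¹≈1))
        (sum-zero _ (λ j → trans (*-congˡ (below j)) (zeroʳ _))))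
      (+-identityʳ 1#)
    left zero (suc k) = begin
      a⁻¹ * r k + sum (λ j → - a⁻¹ * rN j * M (suc j) (suc k))
        ≈⟨ +-congˡ (sum-cong-≋ (λ j → *-assoc (- a⁻¹) (rN j) (M (suc j) (suc k)))) ⟩
      a⁻¹ * r k + sum (λ j → - a⁻¹ * (rN j * M (suc j) (suc k)))
        ≈⟨ +-congˡ (*-distribˡ-sum (- a⁻¹) (λ j → rN j * M (suc j) (suc k))) ⟨
      a⁻¹ * r k + - a⁻¹ * sum (λ j → rN j * M (suc j) (suc k))
        ≈⟨ +-congˡ (*-congˡ (rNM≈r k)) ⟩
      a⁻¹ * r k + - a⁻¹ * r k
        ≈⟨ distribʳ (r k) a⁻¹ (- a⁻¹) ⟨
      (a⁻¹ - a⁻¹) * r k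
        ≈⟨ *-congʳ (-‿inverseʳ a⁻¹) ⟩
      0# * r k
        ≈⟨ zeroˡ (r k) ⟩
      0# ∎
    left (suc i) zero = trans
      (+-cong (zeroˡ (M zero zero))
        (sum-zero _ (λ j → trans (*-congˡ (below j)) (zeroʳ _))))
      (+-identityʳ 0#)
    left (suc i) (suc k) = trans
      (+-cong (zeroˡ (r k)) (NM≈I i k))
      (+-identityˡ _)

  -- Polynomial evaluation

  eval-+ₚ : ∀ p q x → eval (p +ₚ q) x ≈ eval p x + eval q x
  eval-+ₚ []      q       x = sym (+-identityˡ (eval q x))
  eval-+ₚ (a ∷ p) []      x = sym (+-identityʳ (eval (a ∷ p) x))
  eval-+ₚ (a ∷ p) (b ∷ q) x = trans
    (+-congˡ (*-congˡ (eval-+ₚ p q x)))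
    (solve 5 (λ a b x u v →
      (a :+ b) :+ x :* (u :+ v) := (a :+ x :* u) :+ (b :+ x :* v))
      refl a b x (eval p x) (eval q x))

  eval-map-* : ∀ a p x → eval (List.map (a *_) p) x ≈ a * eval p x
  eval-map-* a []      x = sym (zeroʳ a)
  eval-map-* a (b ∷ p) x = trans
    (+-congˡ (*-congˡ (eval-map-* a p x)))
    (solve 4 (λ a b x u → a :* b :+ x :* (a :* u) := a :* (b :+ x :* u))
      refl a b x (eval p x))

  eval-*ₚ : ∀ p q x → eval (p *ₚ q) x ≈ eval p x * eval q x
  eval-*ₚ []      q x = sym (zeroˡ (eval q x))
  eval-*ₚ (a ∷ p) q x = begin
    eval (List.map (a *_) q +ₚ (0# ∷ p *ₚ q)) x
      ≈⟨ eval-+ₚ (List.map (a *_) q) (0# ∷ p *ₚ q) x ⟩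
    eval (List.map (a *_) q) x + (0# + x * eval (p *ₚ q) x)
      ≈⟨ +-cong (eval-map-* a q x)
           (trans (+-identityˡ _) (*-congˡ (eval-*ₚ p q x))) ⟩
    a * eval q x + x * (eval p x * eval q x)
      ≈⟨ solve 4 (λ a x u v → a :* v :+ x :* (u :* v) := (a :+ x :* u) :* v)
           refl a x (eval p x) (eval q x) ⟩
    (a + x * eval p x) * eval q x ∎

  eval--ₚ : ∀ p x → eval (-ₚ p) x ≈ - eval p x
  eval--ₚ []      x = sym -0#≈0#
  eval--ₚ (a ∷ p) x = begin
    - a + x * eval (-ₚ p) x ≈⟨ +-congˡ (*-comm x (eval (-ₚ p) x)) ⟩
    - a + eval (-ₚ p) x * x ≈⟨ +-congˡ (*-congʳ (eval--ₚ p x)) ⟩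
    - a + - eval p x * x    ≈⟨ +-congˡ (-‿distribˡ-* (eval p x) x) ⟨
    - a + - (eval p x * x)  ≈⟨ -‿+-comm a (eval p x * x) ⟩
    - (a + eval p x * x)    ≈⟨ -‿cong (+-congˡ (*-comm (eval p x) x)) ⟩
    - (a + x * eval p x) ∎

  eval-con : ∀ a x → eval (con a) x ≈ a
  eval-con a x = trans (+-congˡ (zeroʳ x)) (+-identityʳ a)

  eval-X : ∀ x → eval X x ≈ x
  eval-X x = trans (+-identityˡ _)
    (trans (*-congˡ (eval-con 1# x)) (*-identityʳ x))

  eval-^ₚ : ∀ p n x → eval (p ^ₚ n) x ≈ eval p x ^ n
  eval-^ₚ p zero    x = eval-con 1# x
  eval-^ₚ p (suc n) x =
    trans (eval-*ₚ p (p ^ₚ n) x) (*-congˡ (eval-^ₚ p n x))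

  eval-sumₚ : ∀ {n} (p : Fin n → Polynomial) x →
              eval (sumₚ p) x ≈ sum (λ i → eval (p i) x)
  eval-sumₚ {zero}  p x = refl
  eval-sumₚ {suc n} p x = trans
    (eval-+ₚ (p zero) (sumₚ (p ∘ suc)) x) (+-congˡ (eval-sumₚ (p ∘ suc) x))

  -- The summands of `F` and, up to sign, those of `G` have this shape, with `p` equal to `X` or
  -- `X +ₚ con 1#`.
  eval-con*^ₚ : ∀ a p n x → eval (con a *ₚ p ^ₚ n) x ≈ a * eval p x ^ n
  eval-con*^ₚ a p n x = trans (eval-*ₚ (con a) (p ^ₚ n) x)
    (*-cong (eval-con a x) (eval-^ₚ p n x))

  -- The matrix A

  A-upperTriangular : ∀ d → UpperTriangular (A d)
  A-upperTriangular d i j j<i with Fin.<-cmp i j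
  ... | tri> _ _ _     = refl
  ... | tri≈ _ _ j≮i   = contradiction j<i j≮i
  ... | tri< _ _ j≮i   = contradiction j<i j≮i

  A-diagonal : ∀ d i → A d i i ≈ fromℕ 2
  A-diagonal d i with Fin.<-cmp i i
  ... | tri> _ i≢i _ = contradiction ≡.refl i≢i
  ... | tri≈ _ _ _   = refl
  ... | tri< _ i≢i _ = contradiction ≡.refl i≢i

  -- The formula for the entries above the diagonal extends to the whole matrix once the identity is
  -- added: below the diagonal the binomial coefficient vanishes, and on the diagonal the formula
  -- gives 3 instead of 2.
  A-entry : ∀ d i j → A d i j + identity (suc d) i j ≈
            fromℕ ((2 ℕ.^ (toℕ j ∸ toℕ i) ℕ.+ 2) ℕ.* (toℕ j C toℕ i))
  A-entry d i j with Fin.<-cmp i j | i Fin.≟ j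
  ... | tri> _ _ i>j   | no _    = trans (+-identityˡ 0#) (fromℕ-cong (≡.sym
        (≡.trans (≡.cong ((2 ℕ.^ (toℕ j ∸ toℕ i) ℕ.+ 2) ℕ.*_) (k>n⇒nCk≡0 i>j))
          (ℕ.*-zeroʳ (2 ℕ.^ (toℕ j ∸ toℕ i) ℕ.+ 2)))))
  ... | tri> _ i≢j _   | yes i≡j = contradiction i≡j i≢j
  ... | tri≈ _ i≡j _   | no i≢j  = contradiction i≡j i≢j
  ... | tri≈ _ ≡.refl _ | yes _
    = trans (+-comm (fromℕ 2) 1#) (fromℕ-cong (≡.sym (≡.cong₂ ℕ._*_
        (≡.cong (λ k → 2 ℕ.^ k ℕ.+ 2) (ℕ.n∸n≡0 (toℕ i))) (nCn≡1 (toℕ i)))))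
  ... | tri< _ i≢j _   | yes i≡j = contradiction i≡j i≢j
  ... | tri< _ _ _     | no _    = +-identityʳ _

  -- Terms with index above `n` vanish with their binomial coefficient, so the expansion may run up
  -- to any `d` that is at least `n`.
  binomial-padded : ∀ {d n} → n ℕ.≤ d → ∀ x c →
    (x + fromℕ c) ^ n ≈
    sum {suc d} (λ i → fromℕ ((n C toℕ i) ℕ.* c ℕ.^ (n ∸ toℕ i)) * x ^ toℕ i)
  binomial-padded {d} {n} n≤d x c = begin
    (x + fromℕ c) ^ n
      ≈⟨ Binomial.theorem n x (fromℕ c) ⟩
    sum {suc n} (λ i → (n C toℕ i) · (x ^ toℕ i * fromℕ c ^ (n ∸ toℕ i)))
      ≈⟨ sum-cong-≋ {suc n} (λ i → coefficient (toℕ i)) ⟩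
    sum {suc n} (term ∘ toℕ)
      ≈⟨ sum-truncate (s≤s n≤d) term (λ k n<k → trans
           (*-congʳ (fromℕ-cong (≡.cong (ℕ._* c ℕ.^ (n ∸ k)) (k>n⇒nCk≡0 n<k))))
           (zeroˡ (x ^ k))) ⟨
    sum {suc d} (term ∘ toℕ) ∎
    where
    term : ℕ → Carrier
    term k = fromℕ ((n C k) ℕ.* c ℕ.^ (n ∸ k)) * x ^ k

    coefficient : ∀ k → (n C k) · (x ^ k * fromℕ c ^ (n ∸ k)) ≈ term k
    coefficient k = begin
      (n C k) · (x ^ k * fromℕ c ^ (n ∸ k))
        ≈⟨ ·-fromℕ (n C k) _ ⟩
      fromℕ (n C k) * (x ^ k * fromℕ c ^ (n ∸ k))
        ≈⟨ *-congˡ (trans (*-comm _ _) (*-congʳ (sym (fromℕ-^ c (n ∸ k))))) ⟩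
      fromℕ (n C k) * (fromℕ (c ℕ.^ (n ∸ k)) * x ^ k)
        ≈⟨ *-assoc _ _ _ ⟨
      fromℕ (n C k) * fromℕ (c ℕ.^ (n ∸ k)) * x ^ k
        ≈⟨ *-congʳ (fromℕ-* (n C k) (c ℕ.^ (n ∸ k))) ⟨
      term k ∎

  -- Summation by parts against the Pell sequence

  module Solution (d : ℕ) (λs : Vector Carrier (suc d)) (sol : IsSolution d λs)
    where

    f : Carrier → Carrier
    f x = sum (λ i → λs i * x ^ toℕ i)

    f-cong : ∀ {x y} → x ≈ y → f x ≈ f y
    f-cong x≈y = sum-cong-≋ {suc d} (λ i → *-congˡ {λs i} (^-congˡ (toℕ i) x≈y))

    -- This is `A d` plus the identity; column `j` holds the coefficients of (x+2)^j + 2 (x+1)^j.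
    entry : Matrix (suc d) (suc d)
    entry i j = fromℕ ((2 ℕ.^ (toℕ j ∸ toℕ i) ℕ.+ 2) ℕ.* (toℕ j C toℕ i))

    entry-*ᵥ : ∀ i → (entry *ᵥ λs) i ≈ rhs d i + λs i
    entry-*ᵥ i = begin
      sum (λ j → entry i j * λs j)
        ≈⟨ sum-cong-≋ (λ j → trans (*-congʳ (sym (A-entry d i j)))
             (distribʳ (λs j) (A d i j) (identity (suc d) i j))) ⟩
      sum (λ j → A d i j * λs j + identity (suc d) i j * λs j)
        ≈⟨ ∑-distrib-+ (λ j → A d i j * λs j) (λ j → identity (suc d) i j * λs j) ⟩
      (A d *ᵥ λs) i + (identity (suc d) *ᵥ λs) i
        ≈⟨ +-cong (sol i) (identity-*ᵥ λs i) ⟩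
      rhs d i + λs i ∎

    -- The coefficient of x^i on the left is C(j,i) 2^(j-i) + 2 C(j,i) 1^(j-i).
    shifted-power : ∀ x j →
      (x + fromℕ 2) ^ toℕ j + fromℕ 2 * (x + fromℕ 1) ^ toℕ j ≈
      sum (λ i → entry i j * x ^ toℕ i)
    shifted-power x j = begin
      (x + fromℕ 2) ^ toℕ j + fromℕ 2 * (x + fromℕ 1) ^ toℕ j
        ≈⟨ +-cong (binomial-padded (Fin.toℕ≤pred[n] j) x 2)
             (trans (*-congˡ (binomial-padded (Fin.toℕ≤pred[n] j) x 1))
               (*-distribˡ-sum (fromℕ 2) (λ i → u 1 i * x ^ toℕ i))) ⟩
      sum (λ i → u 2 i * x ^ toℕ i) + sum (λ i → fromℕ 2 * (u 1 i * x ^ toℕ i))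
        ≈⟨ ∑-distrib-+ (λ i → u 2 i * x ^ toℕ i)
             (λ i → fromℕ 2 * (u 1 i * x ^ toℕ i)) ⟨
      sum (λ i → u 2 i * x ^ toℕ i + fromℕ 2 * (u 1 i * x ^ toℕ i))
        ≈⟨ sum-cong-≋ combine ⟩
      sum (λ i → entry i j * x ^ toℕ i) ∎
      where
      u : ℕ → Vector Carrier (suc d)
      u c i = fromℕ ((toℕ j C toℕ i) ℕ.* c ℕ.^ (toℕ j ∸ toℕ i))

      combine : ∀ i → u 2 i * x ^ toℕ i + fromℕ 2 * (u 1 i * x ^ toℕ i) ≈
                entry i j * x ^ toℕ i
      combine i = begin
        u 2 i * x ^ toℕ i + fromℕ 2 * (u 1 i * x ^ toℕ i)
          ≈⟨ solve 4 (λ a b t y → a :* y :+ t :* (b :* y) := (a :+ t :* b) :* y)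
               refl (u 2 i) (u 1 i) (fromℕ 2) (x ^ toℕ i) ⟩
        (u 2 i + fromℕ 2 * u 1 i) * x ^ toℕ i
          ≈⟨ *-congʳ (+-cong (fromℕ-* b p) (*-congˡ (fromℕ-cong
               (≡.trans (≡.cong (b ℕ.*_) (ℕ.^-zeroˡ (toℕ j ∸ toℕ i)))
                 (ℕ.*-identityʳ b))))) ⟩
        (fromℕ b * fromℕ p + fromℕ 2 * fromℕ b) * x ^ toℕ i
          ≈⟨ *-congʳ (trans (+-congʳ (*-comm (fromℕ b) (fromℕ p)))
               (sym (distribʳ (fromℕ b) (fromℕ p) (fromℕ 2)))) ⟩
        (fromℕ p + fromℕ 2) * fromℕ b * x ^ toℕ i
          ≈⟨ *-congʳ (trans (fromℕ-* (p ℕ.+ 2) b) (*-congʳ (fromℕ-+ p 2))) ⟨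
        entry i j * x ^ toℕ i ∎
        where
        b p : ℕ
        b = toℕ j C toℕ i
        p = 2 ℕ.^ (toℕ j ∸ toℕ i)

    -- The left side is the row of powers of `x` times `entry` times `λs`. Bracketed by columns,
    -- this product shows the shifted powers; bracketed by rows, it becomes `rhs d` plus `λs` by the
    -- linear system, and `rhs d` lists the coefficients of 2 (x+2)^d.
    f-recurrence : ∀ x → f (x + fromℕ 2) + fromℕ 2 * f (x + fromℕ 1) ≈
                   fromℕ 2 * (x + fromℕ 2) ^ d + f x
    f-recurrence x = begin
      f (x + fromℕ 2) + fromℕ 2 * f (x + fromℕ 1)
        ≈⟨ +-congˡ (*-distribˡ-sum (fromℕ 2) (λ j → λs j * y₁ j)) ⟩
      f (x + fromℕ 2) + sum (λ j → fromℕ 2 * (λs j * y₁ j))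
        ≈⟨ ∑-distrib-+ (λ j → λs j * y₂ j) (λ j → fromℕ 2 * (λs j * y₁ j)) ⟨
      sum (λ j → λs j * y₂ j + fromℕ 2 * (λs j * y₁ j))
        ≈⟨ sum-cong-≋ (λ j → solve 4 (λ l t u v →
             l :* u :+ t :* (l :* v) := (u :+ t :* v) :* l)
             refl (λs j) (fromℕ 2) (y₂ j) (y₁ j)) ⟩
      sum (λ j → (y₂ j + fromℕ 2 * y₁ j) * λs j)
        ≈⟨ sum-cong-≋ (λ j → *-congʳ {λs j} (trans (shifted-power x j)
             (sum-cong-≋ (λ i → *-comm (entry i j) (x ^ toℕ i))))) ⟩
      sum (λ j → sum (λ i → x ^ toℕ i * entry i j) * λs j)
        ≈⟨ sum-*-assoc (λ i → x ^ toℕ i) entry λs ⟩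
      sum (λ i → x ^ toℕ i * (entry *ᵥ λs) i)
        ≈⟨ sum-cong-≋ (λ i → trans (*-congˡ (entry-*ᵥ i))
             (solve 4 (λ y t b l → y :* (t :* b :+ l) := t :* (b :* y) :+ l :* y)
               refl (x ^ toℕ i) (fromℕ 2) (b i) (λs i))) ⟩
      sum (λ i → fromℕ 2 * (b i * x ^ toℕ i) + λs i * x ^ toℕ i)
        ≈⟨ ∑-distrib-+ (λ i → fromℕ 2 * (b i * x ^ toℕ i))
             (λ i → λs i * x ^ toℕ i) ⟩
      sum (λ i → fromℕ 2 * (b i * x ^ toℕ i)) + f x
        ≈⟨ +-congʳ (*-distribˡ-sum (fromℕ 2) (λ i → b i * x ^ toℕ i)) ⟨
      fromℕ 2 * sum (λ i → b i * x ^ toℕ i) + f x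
        ≈⟨ +-congʳ (*-congˡ (binomial-padded {d} ℕ.≤-refl x 2)) ⟨
      fromℕ 2 * (x + fromℕ 2) ^ d + f x ∎
      where
      y₁ y₂ b : Vector Carrier (suc d)
      y₁ j = (x + fromℕ 1) ^ toℕ j
      y₂ j = (x + fromℕ 2) ^ toℕ j
      b i  = fromℕ ((d C toℕ i) ℕ.* 2 ℕ.^ (d ∸ toℕ i))

    φ : ℕ → Carrier
    φ n = f (fromℕ n)

    -- `ρ (suc n) * fromℕ (pell n)` is the term k = n + 1 of twice the Pell sum.
    ρ : ℕ → Carrier
    ρ n = fromℕ 2 * fromℕ n ^ d

    φ-recurrence : ∀ n → φ (2 ℕ.+ n) + fromℕ 2 * φ (1 ℕ.+ n) ≈
                   ρ (2 ℕ.+ n) + φ n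
    φ-recurrence n = begin
      φ (2 ℕ.+ n) + fromℕ 2 * φ (1 ℕ.+ n)
        ≈⟨ +-cong (f-cong (shift 2)) (*-congˡ (f-cong (shift 1))) ⟩
      f (fromℕ n + fromℕ 2) + fromℕ 2 * f (fromℕ n + fromℕ 1)
        ≈⟨ f-recurrence (fromℕ n) ⟩
      fromℕ 2 * (fromℕ n + fromℕ 2) ^ d + φ n
        ≈⟨ +-congʳ (*-congˡ (^-congˡ d (shift 2))) ⟨
      ρ (2 ℕ.+ n) + φ n ∎
      where
      shift : ∀ c → fromℕ (c ℕ.+ n) ≈ fromℕ n + fromℕ c
      shift c = trans (fromℕ-+ c n) (+-comm (fromℕ c) (fromℕ n))

    eval-F : ∀ x → eval (F d λs) x ≈ f x
    eval-F x = trans (eval-sumₚ (λ i → con (λs i) *ₚ X ^ₚ toℕ i) x)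
      (sum-cong-≋ (λ i → trans (eval-con*^ₚ (λs i) X (toℕ i) x)
        (*-congˡ (^-congˡ (toℕ i) (eval-X x)))))

    γ : ℕ → Carrier
    γ n = eval (G d λs) (fromℕ n)

    -- By definition G(x) = f(x+1) - 2 (x+1)^d; keeping `ρ` on the left avoids subtraction in the
    -- induction.
    γ+ρ : ∀ n → γ n + ρ (suc n) ≈ φ (suc n)
    γ+ρ n = begin
      γ n + ρ (suc n)
        ≈⟨ +-congʳ (eval-+ₚ (-ₚ P) Q x) ⟩
      eval (-ₚ P) x + eval Q x + ρ (suc n)
        ≈⟨ +-congʳ (+-cong (trans (eval--ₚ P x) (-‿cong eval-P)) eval-Q) ⟩
      - ρ (suc n) + φ (suc n) + ρ (suc n)
        ≈⟨ +-comm _ _ ⟩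
      ρ (suc n) + (- ρ (suc n) + φ (suc n))
        ≈⟨ +-assoc _ _ _ ⟨
      ρ (suc n) - ρ (suc n) + φ (suc n)
        ≈⟨ trans (+-congʳ (-‿inverseʳ (ρ (suc n)))) (+-identityˡ (φ (suc n))) ⟩
      φ (suc n) ∎
      where
      x : Carrier
      x = fromℕ n

      P Q : Polynomial
      P = con (fromℕ 2) *ₚ (X +ₚ con 1#) ^ₚ d
      Q = sumₚ (λ i → con (λs i) *ₚ (X +ₚ con 1#) ^ₚ toℕ i)

      eval-X+1 : eval (X +ₚ con 1#) x ≈ fromℕ (suc n)
      eval-X+1 = begin
        eval (X +ₚ con 1#) x      ≈⟨ eval-+ₚ X (con 1#) x ⟩
        eval X x + eval (con 1#) x ≈⟨ +-cong (eval-X x) (eval-con 1# x) ⟩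
        x + 1#                     ≈⟨ +-comm x 1# ⟩
        1# + x ∎

      eval-P : eval P x ≈ ρ (suc n)
      eval-P = trans (eval-con*^ₚ (fromℕ 2) (X +ₚ con 1#) d x)
        (*-congˡ (^-congˡ d eval-X+1))

      eval-Q : eval Q x ≈ φ (suc n)
      eval-Q = trans (eval-sumₚ (λ i → con (λs i) *ₚ (X +ₚ con 1#) ^ₚ toℕ i) x)
        (sum-cong-≋ (λ i → trans (eval-con*^ₚ (λs i) (X +ₚ con 1#) (toℕ i) x)
          (*-congˡ (^-congˡ (toℕ i) eval-X+1))))

    -- Writing φ(n+2) as γ(n+1) + ρ(n+2) in the recurrence puts ρ(n+2) on both sides, where it
    -- cancels. The result rewrites the coefficient of P_{n+1} in the induction step.
    φ-γ : ∀ n → fromℕ 2 * φ (suc n) + γ (suc n) ≈ φ n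
    φ-γ n = +-cancelʳ (ρ (2 ℕ.+ n)) _ _ (begin
      fromℕ 2 * φ (suc n) + γ (suc n) + ρ (2 ℕ.+ n)
        ≈⟨ +-assoc _ _ _ ⟩
      fromℕ 2 * φ (suc n) + (γ (suc n) + ρ (2 ℕ.+ n))
        ≈⟨ +-congˡ (γ+ρ (suc n)) ⟩
      fromℕ 2 * φ (suc n) + φ (2 ℕ.+ n)
        ≈⟨ +-comm _ _ ⟩
      φ (2 ℕ.+ n) + fromℕ 2 * φ (suc n)
        ≈⟨ φ-recurrence n ⟩
      ρ (2 ℕ.+ n) + φ n
        ≈⟨ +-comm _ _ ⟩
      φ n + ρ (2 ℕ.+ n) ∎)

    -- The sum in `H` is f(2) + 2 f(1), which the recurrence at 0 equates with 2^(d+1) + f(0).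
    eval-H : ∀ x → eval (H d λs) x + φ 0 ≈ 0#
    eval-H x = begin
      eval (H d λs) x + φ 0
        ≈⟨ +-congʳ (trans (eval-con (q - _) x) (+-congˡ (-‿cong weights))) ⟩
      q - (q + φ 0) + φ 0
        ≈⟨ trans (+-assoc _ _ _) (trans (+-congˡ (+-comm _ _))
             (sym (+-assoc _ _ _))) ⟩
      q + φ 0 - (q + φ 0)
        ≈⟨ -‿inverseʳ (q + φ 0) ⟩
      0# ∎
      where
      q : Carrier
      q = fromℕ (2 ℕ.^ suc d)

      weights : sum (λ i → fromℕ (2 ℕ.^ toℕ i ℕ.+ 2) * λs i) ≈ q + φ 0
      weights = begin
        sum (λ i → fromℕ (2 ℕ.^ toℕ i ℕ.+ 2) * λs i)
          ≈⟨ sum-cong-≋ {suc d} (λ i → *-congʳ {λs i} (fromℕ-+ (2 ℕ.^ toℕ i) 2)) ⟩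
        sum (λ i → (fromℕ (2 ℕ.^ toℕ i) + fromℕ 2) * λs i)
          ≈⟨ sum-cong-≋ split ⟩
        sum (λ i → λs i * fromℕ 2 ^ toℕ i +
                   fromℕ 2 * (λs i * fromℕ 1 ^ toℕ i))
          ≈⟨ ∑-distrib-+ (λ i → λs i * fromℕ 2 ^ toℕ i)
               (λ i → fromℕ 2 * (λs i * fromℕ 1 ^ toℕ i)) ⟩
        φ 2 + sum (λ i → fromℕ 2 * (λs i * fromℕ 1 ^ toℕ i))
          ≈⟨ +-congˡ (*-distribˡ-sum (fromℕ 2) (λ i → λs i * fromℕ 1 ^ toℕ i)) ⟨
        φ 2 + fromℕ 2 * φ 1
          ≈⟨ φ-recurrence 0 ⟩
        ρ 2 + φ 0
          ≈⟨ +-congʳ (fromℕ-^ 2 (suc d)) ⟨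
        q + φ 0 ∎
        where
        -- The factor `fromℕ 1 ^ toℕ i` is written in so that the second part sums to 2 φ(1).
        split : ∀ i → (fromℕ (2 ℕ.^ toℕ i) + fromℕ 2) * λs i ≈
                λs i * fromℕ 2 ^ toℕ i + fromℕ 2 * (λs i * fromℕ 1 ^ toℕ i)
        split i = begin
          (fromℕ (2 ℕ.^ toℕ i) + fromℕ 2) * λs i
            ≈⟨ distribʳ (λs i) (fromℕ (2 ℕ.^ toℕ i)) (fromℕ 2) ⟩
          fromℕ (2 ℕ.^ toℕ i) * λs i + fromℕ 2 * λs i
            ≈⟨ +-cong (trans (*-comm _ _) (*-congˡ (fromℕ-^ 2 (toℕ i))))
                 (*-congˡ (trans (sym (*-identityʳ (λs i))) (*-congˡ one))) ⟩
          λs i * fromℕ 2 ^ toℕ i + fromℕ 2 * (λs i * fromℕ 1 ^ toℕ i) ∎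
          where
          one : 1# ≈ fromℕ 1 ^ toℕ i
          one = begin
            1#                  ≈⟨ +-identityʳ 1# ⟨
            fromℕ 1             ≈⟨ fromℕ-cong (ℕ.^-zeroˡ (toℕ i)) ⟨
            fromℕ (1 ℕ.^ toℕ i) ≈⟨ fromℕ-^ 1 (toℕ i) ⟩
            fromℕ 1 ^ toℕ i ∎

    -- The index k starts at 1, so `k ∸ 1` is the ordinary difference.
    pellSum : ℕ → ℕ
    pellSum n = ∑₁ n (λ k → k ℕ.^ d ℕ.* pell (k ∸ 1))

    -- Induction on `n`, with f(0) on the left in place of H on the right. At 0 the sum is empty,
    -- P_1 = 1 and P_0 = 0.
    pell-sum+φ0 : ∀ n → fromℕ 2 * fromℕ (pellSum n) + φ 0 ≈
                  φ n * fromℕ (pell (suc n)) + γ n * fromℕ (pell n)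
    pell-sum+φ0 zero = begin
      fromℕ 2 * 0# + φ 0              ≈⟨ +-congʳ (zeroʳ (fromℕ 2)) ⟩
      0# + φ 0                        ≈⟨ +-comm 0# (φ 0) ⟩
      φ 0 + 0#                        ≈⟨ +-cong (*-identityʳ (φ 0)) (zeroʳ (γ 0)) ⟨
      φ 0 * 1# + γ 0 * 0#             ≈⟨ +-congʳ (*-congˡ (+-identityʳ 1#)) ⟨
      φ 0 * fromℕ 1 + γ 0 * fromℕ 0 ∎
    pell-sum+φ0 (suc n) = begin
      t * fromℕ (pellSum n ℕ.+ suc n ℕ.^ d ℕ.* pell n) + φ 0
        ≈⟨ +-congʳ (*-congˡ (trans
             (fromℕ-+ (pellSum n) (suc n ℕ.^ d ℕ.* pell n))
             (+-congˡ (trans (fromℕ-* (suc n ℕ.^ d) (pell n))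
               (*-congʳ (fromℕ-^ (suc n) d)))))) ⟩
      t * (fromℕ (pellSum n) + fromℕ (suc n) ^ d * P₀) + φ 0
        ≈⟨ solve 5 (λ t s y p z →
             t :* (s :+ y :* p) :+ z := t :* s :+ z :+ t :* y :* p)
             refl t (fromℕ (pellSum n)) (fromℕ (suc n) ^ d) P₀ (φ 0) ⟩
      t * fromℕ (pellSum n) + φ 0 + ρ (suc n) * P₀
        ≈⟨ +-congʳ (pell-sum+φ0 n) ⟩
      φ n * P₁ + γ n * P₀ + ρ (suc n) * P₀
        ≈⟨ solve 5 (λ a b g p r →
             a :* b :+ g :* p :+ r :* p := a :* b :+ (g :+ r) :* p)
             refl (φ n) P₁ (γ n) P₀ (ρ (suc n)) ⟩
      φ n * P₁ + (γ n + ρ (suc n)) * P₀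
        -- The coefficient of P_n has absorbed the new summand and becomes φ(n+1); that of P_{n+1}
        -- is expressed through the values at n + 1.
        ≈⟨ +-cong (*-congʳ (sym (φ-γ n))) (*-congʳ (γ+ρ n)) ⟩
      (t * φ (suc n) + γ (suc n)) * P₁ + φ (suc n) * P₀
        -- Collecting φ(n+1) leaves the factor 2 P_{n+1} + P_n, which is P_{n+2}.
        ≈⟨ solve 5 (λ t f g p q →
             (t :* f :+ g) :* p :+ f :* q := f :* (t :* p :+ q) :+ g :* p)
             refl t (φ (suc n)) (γ (suc n)) P₁ P₀ ⟩
      φ (suc n) * (t * P₁ + P₀) + γ (suc n) * P₁
        ≈⟨ +-congʳ (*-congˡ (trans (fromℕ-+ (2 ℕ.* pell (suc n)) (pell n))
             (+-congʳ (fromℕ-* 2 (pell (suc n)))))) ⟨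
      φ (suc n) * fromℕ (pell (2 ℕ.+ n)) + γ (suc n) * P₁ ∎
      where
      t P₀ P₁ : Carrier
      t  = fromℕ 2
      P₀ = fromℕ (pell n)
      P₁ = fromℕ (pell (suc n))

    -- At ℝ the operations opened here and those opened in Defs are distinct copies
    -- of the operations of Over. Agda identifies nested applications of such copies
    -- only by unfolding the Cauchy sequences, which takes far too long. Therefore
    -- this result and those on A below have variables in place of the subterms;
    -- they are replaced after the passage to ℝ.
    pell-sum : ∀ n {t s x p q F′ G′ H′} →
      t ≡ fromℕ 2 → s ≡ fromℕ (pellSum n) → x ≡ fromℕ n →
      p ≡ fromℕ (pell (n ℕ.+ 1)) → q ≡ fromℕ (pell n) →
      F′ ≡ F d λs → G′ ≡ G d λs → H′ ≡ H d λs →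
      t * s ≈ eval F′ x * p + eval G′ x * q + eval H′ x
    pell-sum n ≡.refl ≡.refl ≡.refl ≡.refl ≡.refl ≡.refl ≡.refl ≡.refl = begin
      s
        ≈⟨ +-identityʳ s ⟨
      s + 0#
        -- Zero is written as H + f(0) to supply the `φ 0` that `pell-sum+φ0` has on its left side.
        ≈⟨ +-congˡ (eval-H (fromℕ n)) ⟨
      s + (h + φ 0)
        ≈⟨ solve 3 (λ s h z → s :+ (h :+ z) := s :+ z :+ h) refl s h (φ 0) ⟩
      s + φ 0 + h
        ≈⟨ +-congʳ (pell-sum+φ0 n) ⟩
      φ n * fromℕ (pell (suc n)) + γ n * fromℕ (pell n) + h
        ≈⟨ +-congʳ (+-congʳ (*-cong (eval-F (fromℕ n))
             (fromℕ-cong (≡.cong pell (ℕ.+-comm n 1))))) ⟨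
      eval (F d λs) (fromℕ n) * fromℕ (pell (n ℕ.+ 1)) + γ n * fromℕ (pell n) + h ∎
      where
      s h : Carrier
      s = fromℕ 2 * fromℕ (pellSum n)
      h = eval (H d λs) (fromℕ n)

  -- Determinant and invertibility of `A d`

  A-det : ∀ d {M} → M ≡ A d → det M ≈ fromℕ (2 ℕ.^ suc d)
  A-det d ≡.refl =
    det-upperTriangular (A d) 2 (A-upperTriangular d) (A-diagonal d)

  -- The diagonal entries of `A d` are all 2, so inverting it takes an inverse of 2, which not every
  -- commutative ring has.
  module _ {half} (2*half≈1 : fromℕ 2 * half ≈ 1#) where

    A-invertible : ∀ d {M} → M ≡ A d → Invertible M
    A-invertible d ≡.refl = upperTriangular⇒invertible (A d) (fromℕ 2) half
      2*half≈1 (A-upperTriangular d) (A-diagonal d)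

    ∃!-solution : ∀ d → ∃! _≈ᵥ_ (IsSolution d)
    ∃!-solution d =
      invertible⇒∃!-solution {M = A d} (A-invertible d ≡.refl) (rhs d)

-- Passage to the real numbers

open import Defs

private
  module Real = OverProperties ℝ-commutativeRing

0≤seq-fromℕ : ∀ m k → 0ℚ ℚ.≤ seq (fromℕ m) k
0≤seq-fromℕ zero    k = ℚ.≤-refl
0≤seq-fromℕ (suc m) k =
  ℚ.+-mono-≤ (ℚ.nonNegative⁻¹ 1ℚ) (0≤seq-fromℕ m k)

-- Every term of the rational sequence of `fromℕ m` is at least 1 for positive `m`, so the null
-- condition fails at ε = 1.
fromℕ≉0 : ∀ m .{{_ : ℕ.NonZero m}} → ¬ (fromℕ m ≈ 0ℝ)
fromℕ≉0 (suc m) (mk≈ null) with N , small ← null 1ℚ (ℚ.positive⁻¹ 1ℚ) =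
  ℚ.<-irrefl ≡.refl (ℚ.<-≤-trans (small N ℕ.≤-refl) 1≤∣x-0∣)
  where
  x = seq (fromℕ (suc m)) N

  1≤x : 1ℚ ℚ.≤ x
  1≤x = ℚ.+-monoʳ-≤ 1ℚ (0≤seq-fromℕ m N)

  1≤∣x-0∣ : 1ℚ ℚ.≤ ℚ.∣ x ℚ.- 0ℚ ∣
  1≤∣x-0∣ = ≡.subst (1ℚ ℚ.≤_)
    (≡.sym (≡.trans (≡.cong ℚ.∣_∣ (ℚ.+-identityʳ x))
      (ℚ.0≤p⇒∣p∣≡p (0≤seq-fromℕ (suc m) N))))
    1≤x

A-invertible : ∀ d {M} → M ≡ A d → Invertible (A d)
A-invertible d M≡A = replace d M≡A
  -- Every term of 2 · ½ - 1 computes to 0, so `ε>0` itself is the required bound from index 0 on.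
  (Real.A-invertible {fromℚ ½} (mk≈ λ _ ε>0 → 0 , λ _ _ → ε>0) d M≡A)
  where
  replace : ∀ d {M} → M ≡ A d → Invertible M → Invertible (A d)
  replace d ≡.refl invertible = invertible

A-det : ∀ d {M} → M ≡ A d → det (A d) ≈ fromℕ (2 ℕ.^ suc d)
A-det d M≡A = replace d M≡A (Real.A-det d M≡A)
  where
  replace : ∀ d {M} → M ≡ A d →
            det M ≈ fromℕ (2 ℕ.^ suc d) → det (A d) ≈ fromℕ (2 ℕ.^ suc d)
  replace d ≡.refl det≈ = det≈

replace-operands : ∀ d λs n {t s x p q F′ G′ H′} →
  t ≡ fromℕ 2 → s ≡ fromℕ (∑₁ n (λ k → k ℕ.^ d ℕ.* pell (k ∸ 1))) →
  x ≡ fromℕ n → p ≡ fromℕ (pell (n ℕ.+ 1)) → q ≡ fromℕ (pell n) →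
  F′ ≡ F d λs → G′ ≡ G d λs → H′ ≡ H d λs →
  t * s ≈ eval F′ x * p + eval G′ x * q + eval H′ x →
  fromℕ 2 * fromℕ (∑₁ n (λ k → k ℕ.^ d ℕ.* pell (k ∸ 1)))
    ≈ eval (F d λs) (fromℕ n) * fromℕ (pell (n ℕ.+ 1))
      + eval (G d λs) (fromℕ n) * fromℕ (pell n)
      + eval (H d λs) (fromℕ n)
replace-operands d λs n ≡.refl ≡.refl ≡.refl ≡.refl ≡.refl ≡.refl ≡.refl ≡.refl
  identity = identity

-- The two copies of the operations are compared while the operands are still variables;
-- `replace-operands` then substitutes the actual terms.
pell-sum : ∀ d λs → IsSolution d λs → ∀ n {t s x p q F′ G′ H′} →
  t ≡ fromℕ 2 → s ≡ fromℕ (∑₁ n (λ k → k ℕ.^ d ℕ.* pell (k ∸ 1))) →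
  x ≡ fromℕ n → p ≡ fromℕ (pell (n ℕ.+ 1)) → q ≡ fromℕ (pell n) →
  F′ ≡ F d λs → G′ ≡ G d λs → H′ ≡ H d λs →
  fromℕ 2 * fromℕ (∑₁ n (λ k → k ℕ.^ d ℕ.* pell (k ∸ 1)))
    ≈ eval (F d λs) (fromℕ n) * fromℕ (pell (n ℕ.+ 1))
      + eval (G d λs) (fromℕ n) * fromℕ (pell n)
      + eval (H d λs) (fromℕ n)
pell-sum d λs sol n t≡ s≡ x≡ p≡ q≡ F≡ G≡ H≡ =
  replace-operands d λs n t≡ s≡ x≡ p≡ q≡ F≡ G≡ H≡
    (Real.Solution.pell-sum d λs sol n t≡ s≡ x≡ p≡ q≡ F≡ G≡ H≡)

theorem1p2 : (d : ℕ) →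
    Invertible (A d)
    × det (A d) ≈ fromℕ (2 ℕ.^ suc d)
    × ¬ (fromℕ (2 ℕ.^ suc d) ≈ 0ℝ)
    × ∃! _≈ᵥ_ (IsSolution d)
    × ((λs : Vector ℝ (suc d)) → IsSolution d λs →
    (n : ℕ) → 1 ℕ.≤ n →
    fromℕ 2 * fromℕ (∑₁ n (λ k → k ℕ.^ d ℕ.* pell (k ∸ 1)))
    ≈ eval (F d λs) (fromℕ n) * fromℕ (pell (n ℕ.+ 1))
    + eval (G d λs) (fromℕ n) * fromℕ (pell n)
    + eval (H d λs) (fromℕ n))
theorem1p2 d =
  A-invertible d ≡.refl ,
  A-det d ≡.refl ,
  fromℕ≉0 (2 ℕ.^ suc d) {{ℕ.m^n≢0 2 (suc d)}} ,
  Real.∃!-solution {fromℚ ½} (mk≈ λ _ ε>0 → 0 , λ _ _ → ε>0) d ,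
  λ λs sol n _ → pell-sum d λs sol n
    ≡.refl ≡.refl ≡.refl ≡.refl ≡.refl ≡.refl ≡.refl ≡.refl
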